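{- $S'_2 = S_2$, that is, $S'_2(k) = S_2(k)$ for all integers $k \ge 0$.
   Context: For an integer $k \ge 0$, $S_2(k)$ denotes the smallest integer $n \ge 0$ such that $2^k$ divides $n!$, except that by convention $S_2(0) = 0$ (equivalently, $S_2(k)$ is the smallest integer $n \ge 0$ with $k \le \sum_{i=1}^n \mathrm{ord}_2(i)$, where $\mathrm{ord}_2(i)$ is the largest $m \ge 0$ such that $2^m$ divides $i$). The sequence $S'_2 : \mathbb{N}_0 \to \mathbb{N}_0$ (with $\mathbb{N}_0 = \{0,1,2,\dots\}$) is defined recursively: $S'_2(0) := 0$, $S'_2(1) := 2$, and for $k \ge 2$, $S'_2(k) := 2 \cdot (k-i+1)$ for the minimal $i \in \{1,\dots,k-1\}$ with $k-i+1 \le S'_2(i)$ (such an $i$ always exists). -}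

module Defs where

open import Data.Nat using (ℕ; zero; suc; _+_; _*_; _∸_; _^_; _!; _≤_; _<_; z≤n; s≤s; _≤?_; _<?_; _≟_)
open import Data.Nat.Properties using (≤-refl; <⇒≢; m+n∸n≡m; m≤n+m; *-monoʳ-≤; m≤n⇒m<n∨m≡n; ≤-pred)
open import Data.Nat.Divisibility using (_∣_; _∣?_; ∣-refl; *-pres-∣; n∣m*n; ∣n⇒∣m*n)
open import Data.Product using (Σ; ∃; _×_; _,_; proj₁; proj₂)
open import Data.Sum using (inj₁; inj₂)
open import Function using (_∘_)
open import Relation.Nullary using (¬_; yes; no; contradiction)
open import Relation.Nullary.Decidable using (_×-dec_)
open import Relation.Unary using (Pred; Decidable)
open import Relation.Binary.PropositionalEquality using (_≡_; refl; sym; trans; subst)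
open import Level using (Level)

private
  variable
    ℓ : Level

IsLeast : Pred ℕ ℓ → ℕ → Set ℓ
IsLeast P n = P n × (∀ m → P m → n ≤ m)

-- The bound n only guarantees that the search succeeds.
least : {P : Pred ℕ ℓ} → Decidable P → (n : ℕ) → P n → ∃ (IsLeast P)
least {P = P} P? n pn with P? 0
... | yes p₀ = 0 , p₀ , λ _ _ → z≤n
least P? zero    pn | no ¬p₀ = contradiction pn ¬p₀
least {P = P} P? (suc n) pn | no ¬p₀ with least (P? ∘ suc) n pn
... | m , pm , m-min = suc m , pm , min
  where
  min : ∀ j → P j → suc m ≤ j
  min zero    pj = contradiction pj ¬p₀
  min (suc j) pj = s≤s (m-min j pj)

2^k∣[k*2]! : ∀ k → 2 ^ k ∣ (k * 2) !
2^k∣[k*2]! zero    = ∣-refl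
2^k∣[k*2]! (suc k) = *-pres-∣ (n∣m*n (suc k) {2}) (∣n⇒∣m*n (suc (k * 2)) (2^k∣[k*2]! k))

S₂ : ℕ → ℕ
S₂ zero      = 0
S₂ k@(suc _) = proj₁ (least (λ n → 2 ^ k ∣? n !) (k * 2) (2^k∣[k*2]! k))

S₂-isLeast : ∀ k → IsLeast (λ n → 2 ^ k ∣ n !) (S₂ k)
S₂-isLeast zero      = ∣-refl , λ _ _ → z≤n
S₂-isLeast k@(suc _) = proj₂ (least (λ n → 2 ^ k ∣? n !) (k * 2) (2^k∣[k*2]! k))

-- i ∈ {1,…,k-1} with k-i+1 ≤ f(i).  The subtraction is exact because i < k.
Admissible : (ℕ → ℕ) → ℕ → ℕ → Set
Admissible f k i = 1 ≤ i × i < k × k ∸ i + 1 ≤ f i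

admissible? : ∀ f k → Decidable (Admissible f k)
admissible? f k i = (1 ≤? i) ×-dec (i <? k) ×-dec (k ∸ i + 1 ≤? f i)

record IsS′₂ (f : ℕ → ℕ) : Set where
  field
    at-0 : f 0 ≡ 0
    at-1 : f 1 ≡ 2
    at-k : ∀ k → 2 ≤ k → ∃ λ i → IsLeast (Admissible f k) i × f k ≡ 2 * (k ∸ i + 1)

-- The existence of an admissible i needs only f ≥ 2 on positive arguments:
-- i = k-1 is then admissible.
AtLeast2 : (ℕ → ℕ) → Set
AtLeast2 f = ∀ i → 1 ≤ i → 2 ≤ f i

leastAdmissible : ∀ f → AtLeast2 f → ∀ k → ∃ (IsLeast (Admissible f (2 + k)))
leastAdmissible f f≥2 k = least (admissible? f (2 + k)) (suc k)
  (s≤s z≤n , ≤-refl , subst (λ d → d + 1 ≤ f (suc k)) (sym (m+n∸n≡m 1 (suc k))) (f≥2 (suc k) (s≤s z≤n)))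

next : ∀ f → AtLeast2 f → ℕ → ℕ
next f f≥2 k = 2 * (2 + k ∸ proj₁ (leastAdmissible f f≥2 k) + 1)

update : (ℕ → ℕ) → ℕ → ℕ → ℕ → ℕ
update f k v i with i ≟ k
... | yes _ = v
... | no  _ = f i

update-≡ : ∀ f k v → update f k v k ≡ v
update-≡ f k v with k ≟ k
... | yes _   = refl
... | no  k≢k = contradiction refl k≢k

update-≢ : ∀ f k v i → ¬ i ≡ k → update f k v i ≡ f i
update-≢ f k v i i≢k with i ≟ k
... | yes i≡k = contradiction i≡k i≢k
... | no  _   = refl

update-AtLeast2 : ∀ f k v → AtLeast2 f → 2 ≤ v → AtLeast2 (update f k v)
update-AtLeast2 f k v f≥2 v≥2 i i≥1 with i ≟ k
... | yes _ = v≥2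
... | no  _ = f≥2 i i≥1

-- Course-of-values recursion: approx k agrees with S′₂ on {0,…,k+1}.  Its value 2
-- at larger arguments is a placeholder that the recursion never consults.
approx : ℕ → Σ (ℕ → ℕ) AtLeast2
approx zero    = (λ { zero → 0 ; (suc _) → 2 }) , λ { (suc _) _ → ≤-refl }
approx (suc k) with approx k
... | f , f≥2 = update f (2 + k) (next f f≥2 k)
              , update-AtLeast2 f (2 + k) _ f≥2 (*-monoʳ-≤ 2 (m≤n+m 1 (2 + k ∸ proj₁ (leastAdmissible f f≥2 k))))

S′₂ : ℕ → ℕ
S′₂ k = proj₁ (approx k) k

private
  approx-stable : ∀ n i → i ≤ suc n → proj₁ (approx n) i ≡ proj₁ (approx (suc n)) i
  approx-stable n i i≤1+n = sym (update-≢ _ (2 + n) _ i (<⇒≢ (s≤s i≤1+n)))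

  approx-S′₂ : ∀ n i → i ≤ n → proj₁ (approx n) i ≡ S′₂ i
  approx-S′₂ zero    zero i≤n = refl
  approx-S′₂ (suc n) i i≤1+n with m≤n⇒m<n∨m≡n i≤1+n
  ... | inj₂ refl = refl
  ... | inj₁ i<1+n = trans (sym (approx-stable n i i≤1+n)) (approx-S′₂ n i (≤-pred i<1+n))

  approx-S′₂-suc : ∀ n i → i ≤ suc n → proj₁ (approx n) i ≡ S′₂ i
  approx-S′₂-suc n i i≤1+n = trans (approx-stable n i i≤1+n) (approx-S′₂ (suc n) i i≤1+n)

  IsLeast-cong : ∀ {f g} k → (∀ i → i < k → f i ≡ g i) →
                 ∀ {i} → IsLeast (Admissible f k) i → IsLeast (Admissible g k) i
  IsLeast-cong k f≗g {i} ((i≥1 , i<k , le) , min) =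
    (i≥1 , i<k , subst (k ∸ i + 1 ≤_) (f≗g i i<k) le) ,
    λ { m (m≥1 , m<k , le′) → min m (m≥1 , m<k , subst (k ∸ m + 1 ≤_) (sym (f≗g m m<k)) le′) }

S′₂-isS′₂ : IsS′₂ S′₂
S′₂-isS′₂ = record { at-0 = refl ; at-1 = refl ; at-k = at-k }
  where
  at-k : ∀ k → 2 ≤ k → ∃ λ i → IsLeast (Admissible S′₂ k) i × S′₂ k ≡ 2 * (k ∸ i + 1)
  at-k (suc zero)    (s≤s ())
  at-k (suc (suc k)) _ =
    let f   = proj₁ (approx k)
        f≥2 = proj₂ (approx k)
        la  = leastAdmissible f f≥2 k
    in proj₁ la
     , IsLeast-cong (2 + k) (λ i i<2+k → approx-S′₂-suc k i (≤-pred i<2+k)) (proj₂ la)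
     , trans (sym (approx-S′₂-suc (suc k) (2 + k) ≤-refl)) (update-≡ f (2 + k) (next f f≥2 k))

{-# OPTIONS --safe #-}
-- Since (2m)! = 2^m · m! · 1·3⋯(2m−1), the power 2^(m+j) divides (2m)! exactly when
-- 2^j divides m!; moreover S₂(i) ≤ n exactly when 2^i ∣ n!.  Hence, with m = k − i, the
-- condition k−i+1 ≤ S₂(i) says that 2^i ∤ m!, that is, 2^k ∤ (2m+1)!, and so
-- 2(m+1) ≤ S₂(k).  The minimality of i supplies the divisibility 2^k ∣ (2(m+1))!.
module Submission where

open import Data.Nat using (ℕ; zero; suc; _+_; _*_; _∸_; _^_; _!; _≤_; _<_; z≤n; s≤s; s≤s⁻¹)
open import Data.Nat.Properties
  using (≤-antisym; ≮⇒≥; <⇒≤; <⇒≱; 1+n≰n; +-comm; +-suc; *-comm; ^-distribˡ-+-*; m^n≢0; m∸n+n≡m; +-∸-assoc)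
open import Data.Nat.Divisibility
  using (_∣_; ∣-trans; ∣1⇒≡1; 1∣_; divides-refl; ∣m+n∣m⇒∣n; n∣m*n; ∣n⇒∣m*n; *-monoʳ-∣; *-cancelˡ-∣; m∣m*n; m≤n⇒m!∣n!)
open import Data.Nat.Induction using (<-rec)
open import Data.Nat.Primality using (euclidsLemma; prime[2])
open import Data.Nat.Tactic.RingSolver using (solve-∀)
open import Data.Product using (_,_)
open import Data.Sum using (inj₁; inj₂)
open import Relation.Nullary using (¬_; contradiction)
open import Relation.Binary.PropositionalEquality using (_≡_; refl; sym; trans; cong; subst)
open import Defs

2∤1+m*2 : ∀ m → ¬ 2 ∣ suc (m * 2)
2∤1+m*2 m 2∣1+m*2 with ∣1⇒≡1 (∣m+n∣m⇒∣n (subst (2 ∣_) (+-comm 1 (m * 2)) 2∣1+m*2) (n∣m*n m))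
... | ()

-- Induction on `k`: by Euclid's lemma one factor 2 lies in `n`, and cancelling it lowers the
-- exponent by one.
2^k∣odd*n⇒2^k∣n : ∀ {o} → ¬ 2 ∣ o → ∀ k {n} → 2 ^ k ∣ o * n → 2 ^ k ∣ n
2^k∣odd*n⇒2^k∣n 2∤o zero {n} _ = 1∣ n
2^k∣odd*n⇒2^k∣n {o} 2∤o (suc k) {n} 2^1+k∣o*n
  with euclidsLemma o n prime[2] (∣-trans (m∣m*n (2 ^ k)) 2^1+k∣o*n)
... | inj₁ 2∣o = contradiction 2∣o 2∤o
... | inj₂ (divides-refl q) = subst (2 * 2 ^ k ∣_) (*-comm 2 q)
  (*-monoʳ-∣ 2 (2^k∣odd*n⇒2^k∣n 2∤o k (*-cancelˡ-∣ 2 (subst (2 * 2 ^ k ∣_) (rearrange o q) 2^1+k∣o*n))))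
  where
  rearrange : ∀ o q → o * (q * 2) ≡ 2 * (o * q)
  rearrange = solve-∀

-- The double factorial (2m-1)!!.
oddFactorial : ℕ → ℕ
oddFactorial zero    = 1
oddFactorial (suc m) = suc (m * 2) * oddFactorial m

2∤oddFactorial : ∀ m → ¬ 2 ∣ oddFactorial m
2∤oddFactorial zero    = 2∤1+m*2 0
2∤oddFactorial (suc m) 2∣ with euclidsLemma (suc (m * 2)) (oddFactorial m) prime[2] 2∣
... | inj₁ p = 2∤1+m*2 m p
... | inj₂ p = 2∤oddFactorial m p

[m*2]!-factorisation : ∀ m → (m * 2) ! ≡ 2 ^ m * (oddFactorial m * m !)
[m*2]!-factorisation zero    = refl
[m*2]!-factorisation (suc m) = trans
  (cong (λ x → suc (suc (m * 2)) * (suc (m * 2) * x)) ([m*2]!-factorisation m))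
  (rearrange m (2 ^ m) (oddFactorial m) (m !))
  where
  rearrange : ∀ m p o f → suc (suc (m * 2)) * (suc (m * 2) * (p * (o * f)))
                        ≡ 2 * p * (suc (m * 2) * o * (suc m * f))
  rearrange = solve-∀

2^j∣m!⇒2^[m+j]∣[m*2]! : ∀ m j → 2 ^ j ∣ m ! → 2 ^ (m + j) ∣ (m * 2) !
2^j∣m!⇒2^[m+j]∣[m*2]! m j 2^j∣m!
  rewrite [m*2]!-factorisation m | ^-distribˡ-+-* 2 m j =
  *-monoʳ-∣ (2 ^ m) (∣n⇒∣m*n (oddFactorial m) 2^j∣m!)

2^[m+j]∣[m*2]!⇒2^j∣m! : ∀ m j → 2 ^ (m + j) ∣ (m * 2) ! → 2 ^ j ∣ m !
2^[m+j]∣[m*2]!⇒2^j∣m! m j 2^[m+j]∣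
  rewrite [m*2]!-factorisation m | ^-distribˡ-+-* 2 m j =
  2^k∣odd*n⇒2^k∣n (2∤oddFactorial m) j (*-cancelˡ-∣ (2 ^ m) {{m^n≢0 2 m}} 2^[m+j]∣)

IsLeast-unique : ∀ {ℓ} {P : ℕ → Set ℓ} {m n} → IsLeast P m → IsLeast P n → m ≡ n
IsLeast-unique (pm , m-min) (pn , n-min) = ≤-antisym (m-min _ pn) (n-min _ pm)

S₂≤n⇒2^k∣n! : ∀ k {n} → S₂ k ≤ n → 2 ^ k ∣ n !
S₂≤n⇒2^k∣n! k S₂≤n with S₂-isLeast k
... | 2^k∣S₂! , _ = ∣-trans 2^k∣S₂! (m≤n⇒m!∣n! S₂≤n)

2^k∣n!⇒S₂≤n : ∀ k {n} → 2 ^ k ∣ n ! → S₂ k ≤ n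
2^k∣n!⇒S₂≤n k 2^k∣n! with S₂-isLeast k
... | _ , S₂-min = S₂-min _ 2^k∣n!

-- Here i = suc j and k = m + i, so that k − i + 1 = suc m.
step-isLeast : ∀ m j → suc m ≤ S₂ (suc j) → 2 ^ j ∣ suc m ! →
               IsLeast (λ n → 2 ^ (m + suc j) ∣ n !) (suc m * 2)
step-isLeast m j m<S₂ 2^j∣[1+m]! =
  -- Regrouping m + (j+1) as (m+1) + j, the factorisation of (2(m+1))! asks only for 2^j ∣ (m+1)!.
  subst (λ k → 2 ^ k ∣ (suc m * 2) !) (sym (+-suc m j)) (2^j∣m!⇒2^[m+j]∣[m*2]! (suc m) j 2^j∣[1+m]!)
  -- If n ≤ 2m+1, then n! divides (2m+1)·(2m)!; the odd factor drops out, and the resulting 2^(j+1)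
  -- ∣ m! contradicts `m<S₂`.
  , λ n 2^k∣n! → ≮⇒≥ λ n<2+m*2 →
      <⇒≱ m<S₂ (2^k∣n!⇒S₂≤n (suc j) (2^[m+j]∣[m*2]!⇒2^j∣m! m (suc j)
        (2^k∣odd*n⇒2^k∣n (2∤1+m*2 m) (m + suc j) (∣-trans 2^k∣n! (m≤n⇒m!∣n! (s≤s⁻¹ n<2+m*2))))))

∸≡1+∸suc : ∀ {m n} → n < m → m ∸ n ≡ suc (m ∸ suc n)
∸≡1+∸suc (s≤s n≤m) = +-∸-assoc 1 n≤m

-- The case j = 0 is the case i = 1 of the recursion, where 0 is excluded from the search.
previous-divides : ∀ {f k} → (∀ {i} → i < k → f i ≡ S₂ i) →
                   ∀ j → suc j < k → (∀ i → Admissible f k i → suc j ≤ i) → 2 ^ j ∣ suc (k ∸ suc j) !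
previous-divides         f≗S₂ zero    _     _   = 1∣ _
previous-divides {f} {k} f≗S₂ (suc j) 2+j<k min = S₂≤n⇒2^k∣n! (suc j)
  -- Here i = j+2: if S₂(i-1) exceeded k-i+1, then i-1 would already be admissible, against
  -- minimality.
  (≮⇒≥ λ lt → 1+n≰n (min (suc j) (s≤s z≤n , 1+j<k , bound lt)))
  where
  1+j<k : suc j < k
  1+j<k = <⇒≤ 2+j<k

  bound : suc (k ∸ suc (suc j)) < S₂ (suc j) → k ∸ suc j + 1 ≤ f (suc j)
  -- Passing from i to i-1 raises k-i+1 by one, which the strictness of `lt` absorbs.
  bound lt rewrite f≗S₂ 1+j<k | +-comm (k ∸ suc j) 1 | ∸≡1+∸suc 1+j<k = lt

-- Strong induction works for any solution `f` of the recursion, since admissibility for `k` reads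
-- `f` only below `k`.
IsS′₂⇒≡S₂ : ∀ {f} → IsS′₂ f → ∀ k → f k ≡ S₂ k
IsS′₂⇒≡S₂ {f} isS′₂ = <-rec (λ k → f k ≡ S₂ k) step
  where
  open IsS′₂ isS′₂

  step : ∀ k → (∀ {i} → i < k → f i ≡ S₂ i) → f k ≡ S₂ k
  step zero          _    = at-0
  -- `S₂ 1` evaluates to 2.
  step (suc zero)    _    = at-1
  step k@(suc (suc _)) f≗S₂ with at-k k (s≤s (s≤s z≤n))
  ... | zero  , ((() , _) , _) , _
  ... | suc j , ((_ , 1+j<k , le) , min) , fk≡ = trans fk≡ (trans
    (trans (*-comm 2 (k ∸ suc j + 1)) (cong (_* 2) (+-comm (k ∸ suc j) 1)))
    -- With m = k-i, both sides are the least n such that 2^k ∣ n!.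
    (IsLeast-unique
      (subst (λ k′ → IsLeast (λ n → 2 ^ k′ ∣ n !) (suc (k ∸ suc j) * 2)) (m∸n+n≡m (<⇒≤ 1+j<k))
        (step-isLeast (k ∸ suc j) j
          (subst (suc (k ∸ suc j) ≤_) (f≗S₂ 1+j<k) (subst (_≤ f (suc j)) (+-comm (k ∸ suc j) 1) le))
          (previous-divides f≗S₂ j 1+j<k min)))
      (S₂-isLeast k)))

theorem4p17 : (k : ℕ) → S′₂ k ≡ S₂ k
theorem4p17 = IsS′₂⇒≡S₂ S′₂-isS′₂
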